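{- Let $b, t, n$ be positive integers with $t \ge b$. Then the set $\mathcal{H}_{b,t}(n)$ of hyper $(b,t)$-ary partitions of $n$, partially ordered by refinement, is a distributive lattice.
   Context: A partition of a positive integer $n$ is a finite multiset $\lambda=\{\lambda_1\ge\cdots\ge\lambda_k\}$ of positive integers (its parts) with $\sum_i\lambda_i=n$. For positive integers $b,t$ with $t\ge b$, a hyper $(b,t)$-ary partition of $n$ is a partition of $n$ all of whose parts are powers $b^j$ of $b$ ($j\ge 0$, so $b^0=1$ is allowed), each part size occurring with multiplicity at most $t$. $\mathcal{H}_{b,t}(n)$ denotes the set of all hyper $(b,t)$-ary partitions of $n$. Refinement order: for partitions $\lambda,\mu$ of $n$, $\mu\le\lambda$ if the parts of $\mu$ can be obtained from $\lambda$ by combining parts, i.e. the multiset of parts of $\lambda$ can be divided into disjoint nonempty groups whose sums, taken as a multiset, are exactly the parts of $\mu$. $\mathcal{H}_{b,t}(n)$ carries the restriction of this order. A poset is a lattice if every pair of elements $x,y$ has a least upper bound $x\lor y$ and a greatest lower bound $x\land y$. A lattice is distributive if $x\lor(y\land z)=(x\lor y)\land(x\lor z)$ and $x\land(y\lor z)=(x\land y)\lor(x\land z)$ for all $x,y,z$. -}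

module Defs where

open import Data.List.Base using (List; []; concat; filter; length; map; sum)
open import Data.List.Relation.Binary.Permutation.Propositional using (_↭_)
open import Data.List.Relation.Unary.All using (All)
open import Data.Nat.Base using (ℕ; _^_; _≤_; _<_)
open import Data.Nat.Properties using (_≟_)
open import Data.Product.Base using (∃-syntax; _×_)
open import Relation.Binary.PropositionalEquality.Core using (_≡_; _≢_)

-- The multiset of parts is a list in arbitrary order; partitions are always
-- compared up to _↭_ of their parts (see _≈_), never by _≡_.
record Partition (n : ℕ) : Set where
  field
    parts    : List ℕ
    positive : All (0 <_) parts
    sums-to  : sum parts ≡ n

open Partition public

multiplicity : ℕ → List ℕ → ℕ
multiplicity p ps = length (filter (p ≟_) ps)

record Hyper (b t n : ℕ) : Set where
  field
    partition : Partition n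
    powers    : All (λ p → ∃[ j ] p ≡ b ^ j) (parts partition)
    bounded   : ∀ p → multiplicity p (parts partition) ≤ t

open Hyper public

-- μ ⊑ λ′: the coarser partition μ is the smaller one.
_⊑_ : ∀ {n} → Partition n → Partition n → Set
μ ⊑ λ′ = ∃[ groups ] All (_≢ []) groups
                   × concat groups ↭ parts λ′
                   × map sum groups ↭ parts μ

module _ {b t n : ℕ} where

  infix 4 _≈_ _≼_

  _≈_ : Hyper b t n → Hyper b t n → Set
  x ≈ y = parts (partition x) ↭ parts (partition y)

  _≼_ : Hyper b t n → Hyper b t n → Set
  x ≼ y = partition x ⊑ partition y

{-# OPTIONS --safe #-}
-- For b ≥ 2, encode a partition x into powers of b by T j = Σ ⌊p / b ^ j⌋ over its parts p.  If b ^ j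
-- has multiplicity m j, then T j = m j + b T (j + 1), so the hyper (b,t)-ary partitions of n correspond
-- to the sequences with T 0 = n and b T (j + 1) ≤ T j ≤ t + b T (j + 1) that are eventually 0.
-- Combining parts can only increase T, since ⌊_/ b ^ j⌋ is superadditive; conversely, if T is pointwise
-- smaller for y than for x, bundling surplus parts of y by b, level by level with carry T x j − T y j,
-- yields x.  So refinement is the reversed pointwise order.  The constraints on T are preserved by
-- pointwise min and max, which therefore are join and meet, and distributivity is inherited from ℕ.
-- For b = 1 the parts all equal 1, so any two partitions are equivalent.
module Submission where

open import Defs
open import Algebra.Definitions using (_DistributesOverˡ_)
open import Data.List.Base using (List; []; _∷_; [_]; _++_; concat; filter; length; map; replicate)
open import Data.List.Membership.Propositional using (_∈_)
open import Data.List.Membership.Propositional.Properties using (∈-∃++; ∈-filter⁻)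
open import Data.List.Properties
  using (∷-injective; ++-assoc; concat-++; concat-map-[_]; filter-++; filter-accept; filter-all; filter-none
        ; length-++; length-replicate; map-++; map-∘; map-cong; map-id; map-replicate)
open import Data.List.Relation.Binary.Permutation.Propositional
  using (_↭_; prep; ↭-refl; ↭-reflexive; ↭-sym; ↭-trans; module PermutationReasoning)
open import Data.List.Relation.Binary.Permutation.Propositional.Properties
  using (All-resp-↭; filter-↭; map⁺; shift; ↭-length; ++⁺ˡ)
open import Data.List.Relation.Unary.All using (All; []; _∷_)
import Data.List.Relation.Unary.All as All
import Data.List.Relation.Unary.All.Properties as All
open import Data.List.Relation.Unary.Any using (here)
open import Data.Nat.Base
open import Data.Nat.DivMod
open import Data.Nat.ListAction using (sum)
open import Data.Nat.ListAction.Properties using (sum-++; sum-↭)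
open import Data.Nat.Properties
open import Data.Nat.Solver using (module +-*-Solver)
open import Data.Product.Base using (∃-syntax; ∃₂; _×_; _,_)
open import Function.Base using (_∘_)
open import Relation.Binary.Definitions using (tri<; tri≈; tri>)
open import Relation.Binary.Lattice.Structures using (IsDistributiveLattice)
open import Relation.Binary.PropositionalEquality hiding ([_])
open import Relation.Nullary.Decidable using (yes; no)
open import Relation.Nullary.Negation using (contradiction)

-- Multiplicities determine a list up to permutation

multiplicity-++ : ∀ p xs ys → multiplicity p (xs ++ ys) ≡ multiplicity p xs + multiplicity p ys
multiplicity-++ p xs ys = trans (cong length (filter-++ (p ≟_) xs ys)) (length-++ (filter (p ≟_) xs))

multiplicity-↭ : ∀ p {xs ys} → xs ↭ ys → multiplicity p xs ≡ multiplicity p ys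
multiplicity-↭ p xs↭ys = ↭-length (filter-↭ (p ≟_) xs↭ys)

multiplicity-none : ∀ {p xs} → All (p ≢_) xs → multiplicity p xs ≡ 0
multiplicity-none {p} p∉xs = cong length (filter-none (p ≟_) p∉xs)

multiplicity-all : ∀ {p xs} → All (p ≡_) xs → multiplicity p xs ≡ length xs
multiplicity-all {p} all = cong length (filter-all (p ≟_) all)

multiplicity-positive⇒∈ : ∀ {p} xs → 0 < multiplicity p xs → p ∈ xs
multiplicity-positive⇒∈ {p} xs 0<m with filter (p ≟_) xs in eq
... | x ∷ _ with ∈-filter⁻ (p ≟_) {xs = xs} (subst (x ∈_) (sym eq) (here refl))
... | x∈xs , refl = x∈xs

multiplicity-head : ∀ x xs → 0 < multiplicity x (x ∷ xs)
multiplicity-head x xs = subst (0 <_) (sym (cong length (filter-accept (x ≟_) refl))) z<s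

-- The head of `xs` has positive multiplicity in `ys`, hence occurs there and can be moved to the
-- front and cancelled. The predicate `P` limits the comparison to values that can occur; with
-- powers of `b` for `P`, only the multiplicities of powers need to be known.
multiplicity⇒↭ : ∀ {P : ℕ → Set} {xs ys} → All P xs → All P ys →
                 (∀ {p} → P p → multiplicity p xs ≡ multiplicity p ys) → xs ↭ ys
multiplicity⇒↭ {ys = []} [] [] eq = ↭-refl
multiplicity⇒↭ {ys = y ∷ ys} [] (py ∷ _) eq =
  contradiction (subst (0 <_) (sym (eq py)) (multiplicity-head y ys)) λ ()
multiplicity⇒↭ {xs = x ∷ xs} {ys} (px ∷ pxs) pys eq
  with us , vs , refl ← ∈-∃++ (multiplicity-positive⇒∈ ys (subst (0 <_) (eq px) (multiplicity-head x xs))) =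
  ↭-trans (prep x (multiplicity⇒↭ pxs (All.tail pys′) eq′)) (↭-sym (shift x us vs))
  where
  pys′ = All-resp-↭ (shift x us vs) pys
  eq′ : ∀ {p} → _ → multiplicity p xs ≡ multiplicity p (us ++ vs)
  eq′ {p} pp = +-cancelˡ-≡ (multiplicity p [ x ]) _ _ (begin
    multiplicity p [ x ] + multiplicity p xs          ≡⟨ multiplicity-++ p [ x ] xs ⟨
    multiplicity p (x ∷ xs)                           ≡⟨ eq pp ⟩
    multiplicity p (us ++ x ∷ vs)                     ≡⟨ multiplicity-↭ p (shift x us vs) ⟩
    multiplicity p (x ∷ us ++ vs)                     ≡⟨ multiplicity-++ p [ x ] (us ++ vs) ⟩
    multiplicity p [ x ] + multiplicity p (us ++ vs)  ∎)
    where open ≡-Reasoning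

-- Bundling groups of equal sum

sum-concat : ∀ xss → sum (concat xss) ≡ sum (map sum xss)
sum-concat []         = refl
sum-concat (xs ∷ xss) = trans (sum-++ xs (concat xss)) (cong (sum xs +_) (sum-concat xss))

sum-replicate : ∀ k m → sum (replicate k m) ≡ k * m
sum-replicate zero    m = refl
sum-replicate (suc k) m = cong (m +_) (sum-replicate k m)

replicate-+ : ∀ {A : Set} k l {x : A} → replicate (k + l) x ≡ replicate k x ++ replicate l x
replicate-+ zero    l = refl
replicate-+ (suc k) l = cong (_ ∷_) (replicate-+ k l)

map-≡-++ : ∀ {A B : Set} (f : A → B) xs ys {zs} → map f xs ≡ ys ++ zs →
           ∃₂ λ us vs → us ++ vs ≡ xs × map f us ≡ ys × map f vs ≡ zs
map-≡-++ f xs       []       eq   = [] , xs , refl , refl , eq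
map-≡-++ f (x ∷ xs) (_ ∷ ys) eq
  with refl , eq′ ← ∷-injective eq
  with us , vs , refl , refl , eq″ ← map-≡-++ f xs ys eq′ = x ∷ us , vs , refl , refl , eq″

-- The carry operation: every `b` consecutive groups of sum `q` are merged into one group of sum
-- `b * q`, without touching the underlying parts.
chunk : ∀ d b q xss → map sum xss ≡ replicate (d * b) q →
        ∃[ yss ] concat yss ≡ concat xss × map sum yss ≡ replicate d (b * q)
chunk zero    b q []  eq = [] , refl , refl
chunk (suc d) b q xss eq
  with us , vs , refl , us≡ , vs≡ ← map-≡-++ sum xss (replicate b q) (trans eq (replicate-+ b (d * b)))
  with yss , concat≡ , sums≡ ← chunk d b q vs vs≡ =
  concat us ∷ yss ,
  trans (cong (concat us ++_) concat≡) (concat-++ us vs) ,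
  cong₂ _∷_ (trans (sum-concat us) (trans (cong sum us≡) (sum-replicate b q))) sums≡

concat-replicate-[_] : ∀ {A : Set} (x : A) k → concat (replicate k [ x ]) ≡ replicate k x
concat-replicate-[ x ] k = trans (cong concat (sym (map-replicate [_] k x))) (concat-map-[ replicate k x ])

-- One level of the carrying process. The `c` incoming groups and `m` single parts form a pool of
-- items of weight `q`; the first `m′` are final, and the remaining `d * b` go up as `d` bundles.
regroup-level : ∀ {b q c m m′ d} → c + m ≡ m′ + d * b → ∀ gs → map sum gs ≡ replicate c q →
  ∃₂ λ us vs → concat us ++ concat vs ≡ concat gs ++ replicate m q ×
               map sum us ≡ replicate m′ q × map sum vs ≡ replicate d (b * q)
regroup-level {b} {q} {c} {m} {m′} {d} carry gs sums =
  let pool = gs ++ replicate m [ q ]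
      us , ws , us++ws≡pool , us-sums , ws-sums = map-≡-++ sum pool (replicate m′ q) pool-sums
      vs , vs≡ws , vs-sums = chunk d b q ws ws-sums
  in us , vs , (begin
    concat us ++ concat vs                  ≡⟨ cong (concat us ++_) vs≡ws ⟩
    concat us ++ concat ws                  ≡⟨ concat-++ us ws ⟩
    concat (us ++ ws)                       ≡⟨ cong concat us++ws≡pool ⟩
    concat pool                             ≡⟨ concat-++ gs _ ⟨
    concat gs ++ concat (replicate m [ q ]) ≡⟨ cong (concat gs ++_) (concat-replicate-[ q ] m) ⟩
    concat gs ++ replicate m q              ∎) , us-sums , vs-sums
  where
  open ≡-Reasoning
  pool-sums : map sum (gs ++ replicate m [ q ]) ≡ replicate m′ q ++ replicate (d * b) q
  pool-sums = begin
    map sum (gs ++ replicate m [ q ])           ≡⟨ map-++ sum gs _ ⟩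
    map sum gs ++ map sum (replicate m [ q ])   ≡⟨ cong₂ _++_ sums (map-replicate sum m _) ⟩
    replicate c q ++ replicate m (q + 0)        ≡⟨ cong (λ r → replicate c q ++ replicate m r) (+-identityʳ q) ⟩
    replicate c q ++ replicate m q              ≡⟨ replicate-+ c m ⟨
    replicate (c + m) q                         ≡⟨ cong (λ l → replicate l q) carry ⟩
    replicate (m′ + d * b) q                    ≡⟨ replicate-+ m′ _ ⟩
    replicate m′ q ++ replicate (d * b) q       ∎

-- Sums of floors and their behaviour under combining parts

/-superadditive : ∀ m n d .{{_ : NonZero d}} → m / d + n / d ≤ (m + n) / d
/-superadditive m n d = begin
  m / d + n / d                ≡⟨ m*n/n≡m (m / d + n / d) d ⟨
  (m / d + n / d) * d / d      ≡⟨ /-congˡ (*-distribʳ-+ d (m / d) (n / d)) ⟩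
  (m / d * d + n / d * d) / d  ≤⟨ /-monoˡ-≤ d (+-mono-≤ (m/n*n≤m m d) (m/n*n≤m n d)) ⟩
  (m + n) / d                  ∎
  where open ≤-Reasoning

floorSum : (d : ℕ) .{{_ : NonZero d}} → List ℕ → ℕ
floorSum d xs = sum (map (_/ d) xs)

module _ (d : ℕ) .{{_ : NonZero d}} where

  floorSum-++ : ∀ xs ys → floorSum d (xs ++ ys) ≡ floorSum d xs + floorSum d ys
  floorSum-++ xs ys = trans (cong sum (map-++ (_/ d) xs ys)) (sum-++ (map (_/ d) xs) _)

  floorSum-↭ : ∀ {xs ys} → xs ↭ ys → floorSum d xs ≡ floorSum d ys
  floorSum-↭ xs↭ys = sum-↭ (map⁺ (_/ d) xs↭ys)

  floorSum≤sum/ : ∀ xs → floorSum d xs ≤ sum xs / d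
  floorSum≤sum/ []       = z≤n
  floorSum≤sum/ (x ∷ xs) = ≤-trans (+-monoʳ-≤ (x / d) (floorSum≤sum/ xs)) (/-superadditive x (sum xs) d)

  -- Superadditivity of the floor, applied within each group: replacing a group by its sum can only
  -- raise the total.
  floorSum-concat : ∀ xss → floorSum d (concat xss) ≤ floorSum d (map sum xss)
  floorSum-concat []         = z≤n
  floorSum-concat (xs ∷ xss) = begin
    floorSum d (xs ++ concat xss)              ≡⟨ floorSum-++ xs (concat xss) ⟩
    floorSum d xs + floorSum d (concat xss)    ≤⟨ +-mono-≤ (floorSum≤sum/ xs) (floorSum-concat xss) ⟩
    sum xs / d + floorSum d (map sum xss)      ∎
    where open ≤-Reasoning

  floorSum-vanishes : ∀ {xs} → sum xs < d → floorSum d xs ≡ 0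
  floorSum-vanishes {xs} sum<d = n≤0⇒n≡0 (≤-trans (floorSum≤sum/ xs) (≤-reflexive (m<n⇒m/n≡0 sum<d)))

  floorSum-⊑ : ∀ {n} {μ λ′ : Partition n} → μ ⊑ λ′ → floorSum d (parts λ′) ≤ floorSum d (parts μ)
  floorSum-⊑ {_} {μ} {λ′} (gs , _ , concat↭ , sums↭) = begin
    floorSum d (parts λ′)     ≡⟨ floorSum-↭ concat↭ ⟨
    floorSum d (concat gs)    ≤⟨ floorSum-concat gs ⟩
    floorSum d (map sum gs)   ≡⟨ floorSum-↭ sums↭ ⟩
    floorSum d (parts μ)      ∎
    where open ≤-Reasoning

floorSum-1 : ∀ xs → floorSum 1 xs ≡ sum xs
floorSum-1 xs = cong sum (trans (map-cong n/1≡n xs) (map-id xs))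

n<b^n : ∀ {b} → 1 < b → ∀ n → n < b ^ n
n<b^n         1<b zero    = z<s
n<b^n {b@(suc _)} 1<b (suc n) = begin-strict
  suc n        ≤⟨ n<b^n 1<b n ⟩
  b ^ n        <⟨ m<m*n (b ^ n) b {{m^n≢0 b n}} 1<b ⟩
  b ^ n * b    ≡⟨ *-comm (b ^ n) b ⟩
  b * b ^ n    ∎
  where open ≤-Reasoning

-- Profiles and their pointwise minimum and maximum

-- The sequences T: at j = Σ_{i ≥ j} mᵢ b^(i-j), where mᵢ is the multiplicity of b ^ i.
record Profile (b t n : ℕ) : Set where
  field
    at       : ℕ → ℕ
    at-zero  : at 0 ≡ n
    lower    : ∀ j → b * at (suc j) ≤ at j
    upper    : ∀ j → at j ≤ t + b * at (suc j)
    vanishes : ∀ {j} → n ≤ j → at j ≡ 0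

open Profile

module _ {b t n : ℕ} where

  -- Treats minimum and maximum at once. Both bounds of a profile are built from scaling by `b` and
  -- adding `t`, so an operation that is monotone, idempotent and compatible with these preserves
  -- them.
  pointwise : (_⊕_ : ℕ → ℕ → ℕ) → (∀ {k l m o} → k ≤ l → m ≤ o → k ⊕ m ≤ l ⊕ o) →
              (∀ m k l → m * (k ⊕ l) ≡ (m * k) ⊕ (m * l)) →
              (∀ m k l → m + (k ⊕ l) ≡ (m + k) ⊕ (m + l)) →
              (∀ m → m ⊕ m ≡ m) → Profile b t n → Profile b t n → Profile b t n
  pointwise _⊕_ mono *-distrib +-distrib idem f g = record
    { at       = λ j → at f j ⊕ at g j
    ; at-zero  = trans (cong₂ _⊕_ (at-zero f) (at-zero g)) (idem n)
    ; lower    = λ j → ≤-trans (≤-reflexive (*-distrib b _ _)) (mono (lower f j) (lower g j))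
    ; upper    = λ j → ≤-trans (mono (upper f j) (upper g j))
        (≤-reflexive (sym (trans (cong (t +_) (*-distrib b _ _)) (+-distrib t _ _))))
    ; vanishes = λ n≤j → trans (cong₂ _⊕_ (vanishes f n≤j) (vanishes g n≤j)) (idem 0)
    }

  _⊓ₚ_ _⊔ₚ_ : Profile b t n → Profile b t n → Profile b t n
  _⊓ₚ_ = pointwise _⊓_ ⊓-mono-≤ *-distribˡ-⊓ +-distribˡ-⊓ ⊓-idem
  _⊔ₚ_ = pointwise _⊔_ ⊔-mono-≤ *-distribˡ-⊔ +-distribˡ-⊔ ⊔-idem

-- Tail sums of powers of b

module Radix (b : ℕ) (1<b : 1 < b) where

  instance
    b≢0 : NonZero b
    b≢0 = >-nonZero (<-trans z<s 1<b)

  Power : ℕ → Set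
  Power p = ∃[ j ] p ≡ b ^ j

  b^-mono-< : ∀ {i j} → i < j → b ^ i < b ^ j
  b^-mono-< = ^-monoʳ-< b 1<b

  tailSum : ℕ → List ℕ → ℕ
  tailSum j = floorSum (b ^ j) {{m^n≢0 b j}}

  tailSum-power-< : ∀ {i j} → i < j → tailSum j [ b ^ i ] ≡ 0
  tailSum-power-< {i} {j} i<j = floorSum-vanishes (b ^ j) {{m^n≢0 b j}} {[ b ^ i ]}
    (subst (_< b ^ j) (sym (+-identityʳ _)) (b^-mono-< i<j))

  tailSum-power-+ : ∀ j k → tailSum j [ b ^ (j + k) ] ≡ b ^ k
  tailSum-power-+ j k = begin
    b ^ (j + k) / b ^ j + 0       ≡⟨ +-identityʳ _ ⟩
    b ^ (j + k) / b ^ j           ≡⟨ /-congˡ (trans (^-distribˡ-+-* b j k) (*-comm (b ^ j) (b ^ k))) ⟩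
    b ^ k * b ^ j / b ^ j         ≡⟨ m*n/n≡m (b ^ k) (b ^ j) ⟩
    b ^ k                         ∎
    where
    open ≡-Reasoning
    instance
      b^j≢0 : NonZero (b ^ j)
      b^j≢0 = m^n≢0 b j

  -- For the single part `b ^ i`: below level `j` both tail sums vanish; at level `j` the
  -- multiplicity supplies the 1; above it, one factor `b` separates the two quotients.
  tailSum-step-power : ∀ j {p} → Power p →
                       tailSum j [ p ] ≡ multiplicity (b ^ j) [ p ] + b * tailSum (suc j) [ p ]
  tailSum-step-power j {p} (i , refl) with <-cmp i j
  ... | tri< i<j _ _ = begin
    tailSum j [ b ^ i ]                       ≡⟨ tailSum-power-< i<j ⟩
    0                                         ≡⟨ *-zeroʳ b ⟨
    b * 0                                     ≡⟨ cong (b *_) (tailSum-power-< (m<n⇒m<1+n i<j)) ⟨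
    b * T′                                    ≡⟨ cong (_+ b * T′) (multiplicity-none (>⇒≢ (b^-mono-< i<j) ∷ [])) ⟨
    multiplicity (b ^ j) [ b ^ i ] + b * T′   ∎
    where
    open ≡-Reasoning
    T′ = tailSum (suc j) [ b ^ i ]
  ... | tri≈ _ refl _ = begin
    tailSum i [ b ^ i ]                       ≡⟨ cong (_+ 0) (n/n≡1 (b ^ i) {{m^n≢0 b i}}) ⟩
    1                                         ≡⟨ cong suc (*-zeroʳ b) ⟨
    1 + b * 0                                 ≡⟨ cong (λ v → 1 + b * v) (tailSum-power-< (n<1+n i)) ⟨
    1 + b * T′                                ≡⟨ cong (_+ b * T′) (multiplicity-all {b ^ i} (refl ∷ [])) ⟨
    multiplicity (b ^ i) [ b ^ i ] + b * T′   ∎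
    where
    open ≡-Reasoning
    T′ = tailSum (suc i) [ b ^ i ]
  ... | tri> _ _ j<i with k , refl ← m≤n⇒∃[o]m+o≡n j<i = begin
    tailSum j [ b ^ (suc j + k) ]             ≡⟨ cong (λ l → tailSum j [ b ^ l ]) (+-suc j k) ⟨
    tailSum j [ b ^ (j + suc k) ]             ≡⟨ tailSum-power-+ j (suc k) ⟩
    b * b ^ k                                 ≡⟨ cong (b *_) (tailSum-power-+ (suc j) k) ⟨
    b * T′                                    ≡⟨ cong (_+ b * T′) (multiplicity-none (<⇒≢ (b^-mono-< j<i) ∷ [])) ⟨
    multiplicity (b ^ j) [ b ^ i ] + b * T′   ∎
    where
    open ≡-Reasoning
    T′ = tailSum (suc j) [ b ^ i ]

  tailSum-step : ∀ j {xs} → All Power xs → tailSum j xs ≡ multiplicity (b ^ j) xs + b * tailSum (suc j) xs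
  tailSum-step j [] = sym (*-zeroʳ b)
  tailSum-step j {x ∷ xs} (px ∷ pxs) = begin
    T j (x ∷ xs)                                        ≡⟨ floorSum-++ _ {{m^n≢0 b j}} [ x ] xs ⟩
    T j [ x ] + T j xs                                  ≡⟨ cong₂ _+_ (tailSum-step-power j px) (tailSum-step j pxs) ⟩
    (m [ x ] + b * T′ [ x ]) + (m xs + b * T′ xs)       ≡⟨ regroup (m [ x ]) b (T′ [ x ]) (m xs) (T′ xs) ⟩
    (m [ x ] + m xs) + b * (T′ [ x ] + T′ xs)           ≡⟨ cong₂ (λ u v → u + b * v) (multiplicity-++ (b ^ j) [ x ] xs)
                                                             (floorSum-++ _ {{m^n≢0 b (suc j)}} [ x ] xs) ⟨
    m (x ∷ xs) + b * T′ (x ∷ xs)                        ∎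
    where
    open ≡-Reasoning
    open +-*-Solver
    T = tailSum
    T′ = tailSum (suc j)
    m = multiplicity (b ^ j)
    regroup = solve 5 (λ u c v w z → (u :+ c :* v) :+ (w :+ c :* z) := (u :+ w) :+ c :* (v :+ z)) refl

  tailSum-zero : ∀ xs → tailSum 0 xs ≡ sum xs
  tailSum-zero = floorSum-1

  tailSum-vanishes : ∀ {j xs} → sum xs ≤ j → tailSum j xs ≡ 0
  tailSum-vanishes {j} {xs} sum≤j =
    floorSum-vanishes (b ^ j) {{m^n≢0 b j}} {xs} (≤-<-trans sum≤j (n<b^n 1<b j))

  -- Downward induction from `N`, where both sequences are 0; in `go`, the fuel `k` covers the
  -- distance from `j` to `N`.
  recurrence-unique : ∀ {m f g : ℕ → ℕ} {N} →
    (∀ j → f j ≡ m j + b * f (suc j)) → (∀ j → g j ≡ m j + b * g (suc j)) →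
    (∀ {j} → N ≤ j → f j ≡ 0) → (∀ {j} → N ≤ j → g j ≡ 0) → ∀ j → f j ≡ g j
  recurrence-unique {m} {f} {g} {N} f-step g-step f-zero g-zero j = go N j (m≤m+n N j)
    where
    go : ∀ k j → N ≤ k + j → f j ≡ g j
    go zero    j N≤j = trans (f-zero N≤j) (sym (g-zero N≤j))
    go (suc k) j N≤j = begin
      f j                    ≡⟨ f-step j ⟩
      m j + b * f (suc j)    ≡⟨ cong (λ v → m j + b * v) (go k (suc j) (subst (N ≤_) (sym (+-suc k j)) N≤j)) ⟩
      m j + b * g (suc j)    ≡⟨ g-step j ⟨
      g j                    ∎
      where open ≡-Reasoning

  -- Lists of powers with prescribed multiplicities, and their regrouping

  -- A normal form ordered by level. The window of `k` levels starts at a variable `j` so that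
  -- inductions can proceed one level at a time.
  expand : (m : ℕ → ℕ) (j k : ℕ) → List ℕ
  expand m j zero    = []
  expand m j (suc k) = replicate (m j) (b ^ j) ++ expand m (suc j) k

  module _ (m : ℕ → ℕ) where

    -- The bound `j ≤ i` is kept because it shows that the levels after the first contribute no
    -- further copies of the first power.
    expand-powers : ∀ j k → All (λ p → ∃[ i ] j ≤ i × p ≡ b ^ i) (expand m j k)
    expand-powers j zero    = []
    expand-powers j (suc k) = All.++⁺ (All.replicate⁺ (m j) (j , ≤-refl , refl))
      (All.map (λ (i , j<i , eq) → i , <⇒≤ j<i , eq) (expand-powers (suc j) k))

    multiplicity-expand : ∀ j k → (∀ {i} → k + j ≤ i → m i ≡ 0) →
                          ∀ {i} → j ≤ i → multiplicity (b ^ i) (expand m j k) ≡ m i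
    multiplicity-expand j zero    zeros j≤i = sym (zeros j≤i)
    multiplicity-expand j (suc k) zeros {i} j≤i = trans (multiplicity-++ (b ^ i) (replicate (m j) (b ^ j)) _) rest
      where
      rest : multiplicity (b ^ i) (replicate (m j) (b ^ j)) + multiplicity (b ^ i) (expand m (suc j) k) ≡ m i
      rest with <-cmp j i
      ... | tri< j<i _ _ = cong₂ _+_
        (multiplicity-none (All.replicate⁺ (m j) (>⇒≢ (b^-mono-< j<i))))
        (multiplicity-expand (suc j) k (λ {l} → zeros {l} ∘ subst (_≤ l) (+-suc k j)) j<i)
      ... | tri≈ _ refl _ = trans (cong₂ _+_
        (trans (multiplicity-all (All.replicate⁺ (m j) refl)) (length-replicate (m j)))
        (multiplicity-none (All.map (λ { (l , j<l , refl) → <⇒≢ (b^-mono-< j<l) }) (expand-powers (suc j) k))))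
        (+-identityʳ (m j))
      ... | tri> _ _ i<j = contradiction i<j (≤⇒≯ j≤i)

  -- Level by level: of the items of weight b ^ j (carried groups and single parts), m′ j become
  -- groups for the parts b ^ j of the coarser partition, and the rest is carried in bundles of b.
  group : ∀ {c m m′ : ℕ → ℕ} → (∀ j → c j + m j ≡ m′ j + c (suc j) * b) →
          ∀ k j → c (k + j) ≡ 0 → ∀ gs → map sum gs ≡ replicate (c j) (b ^ j) →
          ∃[ groups ] concat groups ↭ concat gs ++ expand m j k × map sum groups ≡ expand m′ j k
  -- The final carry is 0, so no group is left over.
  group carry zero j c≡0 gs sums with gs | trans sums (cong (λ l → replicate l (b ^ j)) c≡0)
  ... | [] | _ = [] , ↭-refl , refl
  group {c} {m} {m′} carry (suc k) j c≡0 gs sums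
    with us , vs , concat≡ , us-sums , vs-sums ←
           regroup-level {b} {m = m j} {m′ = m′ j} {d = c (suc j)} (carry j) gs sums
    with ws , ws↭ , ws-sums ←
           group {c} {m} {m′} carry k (suc j) (trans (cong c (+-suc k j)) c≡0) vs vs-sums =
    us ++ ws , perm , trans (map-++ sum us ws) (cong₂ _++_ us-sums ws-sums)
    where
    E = expand m (suc j) k
    perm : concat (us ++ ws) ↭ concat gs ++ replicate (m j) (b ^ j) ++ E
    perm = begin
      concat (us ++ ws)                               ≡⟨ concat-++ us ws ⟨
      concat us ++ concat ws                          ↭⟨ ++⁺ˡ (concat us) ws↭ ⟩
      concat us ++ concat vs ++ E                     ≡⟨ ++-assoc (concat us) (concat vs) E ⟨
      (concat us ++ concat vs) ++ E                   ≡⟨ cong (_++ E) concat≡ ⟩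
      (concat gs ++ replicate (m j) (b ^ j)) ++ E     ≡⟨ ++-assoc (concat gs) _ E ⟩
      concat gs ++ replicate (m j) (b ^ j) ++ E       ∎
      where open PermutationReasoning

  multiplicity-bounded : ∀ {t xs} → All Power xs → (∀ i → multiplicity (b ^ i) xs ≤ t) → ∀ p → multiplicity p xs ≤ t
  multiplicity-bounded {t} {xs} powers bound p with 0 <? multiplicity p xs
  ... | no  mult≯0 = subst (_≤ t) (sym (n≤0⇒n≡0 (≮⇒≥ mult≯0))) z≤n
  ... | yes mult>0 with i , refl ← All.lookup powers (multiplicity-positive⇒∈ xs mult>0) = bound i

  -- Correspondence between hyper partitions and profiles

  module _ {t n : ℕ} where

    T : Hyper b t n → ℕ → ℕ
    T x j = tailSum j (parts (partition x))

    mult : Hyper b t n → ℕ → ℕ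
    mult x j = multiplicity (b ^ j) (parts (partition x))

    T-step : ∀ x j → T x j ≡ mult x j + b * T x (suc j)
    T-step x j = tailSum-step j (powers x)

    T-zero : ∀ x → T x 0 ≡ n
    T-zero x = trans (tailSum-zero (parts (partition x))) (sums-to (partition x))

    T-vanishes : ∀ x {j} → n ≤ j → T x j ≡ 0
    T-vanishes x {j} n≤j = tailSum-vanishes {j} {parts (partition x)} (subst (_≤ j) (sym (sums-to (partition x))) n≤j)

    mult-vanishes : ∀ x {j} → n ≤ j → mult x j ≡ 0
    mult-vanishes x {j} n≤j = m+n≡0⇒m≡0 (mult x j) (trans (sym (T-step x j)) (T-vanishes x n≤j))

    profile : Hyper b t n → Profile b t n
    profile x = record
      { at       = T x
      ; at-zero  = T-zero x
      ; lower    = λ j → subst (b * T x (suc j) ≤_) (sym (T-step x j)) (m≤n+m _ (mult x j))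
      ; upper    = λ j → subst (_≤ t + b * T x (suc j)) (sym (T-step x j)) (+-monoˡ-≤ _ (bounded x (b ^ j)))
      ; vanishes = T-vanishes x
      }

    module _ (f : Profile b t n) where

      -- The multiplicity of `b ^ j` read off from the recurrence; `lower` guarantees that the
      -- subtraction does not truncate.
      digit : ℕ → ℕ
      digit j = at f j ∸ b * at f (suc j)

      digit-vanishes : ∀ {j} → n ≤ j → digit j ≡ 0
      digit-vanishes {j} n≤j = n≤0⇒n≡0 (≤-trans (m∸n≤m (at f j) (b * at f (suc j))) (≤-reflexive (vanishes f n≤j)))

      multiplicity-digit : ∀ j → multiplicity (b ^ j) (expand digit 0 n) ≡ digit j
      multiplicity-digit j =
        multiplicity-expand digit 0 n (λ {i} → digit-vanishes ∘ subst (_≤ i) (+-identityʳ n)) z≤n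

      expand-digit-powers : All Power (expand digit 0 n)
      expand-digit-powers = All.map (λ (i , _ , eq) → i , eq) (expand-powers digit 0 n)

      tailSum-digit : ∀ j → tailSum j (expand digit 0 n) ≡ at f j
      -- The sum of the expansion is not yet known to be `n`, as that follows from this lemma. Hence
      -- the threshold adds both: `at f` vanishes from `n` on, the tail sums from the sum on.
      tailSum-digit = recurrence-unique {N = n + sum (expand digit 0 n)}
        (λ j → trans (tailSum-step j expand-digit-powers)
          (cong (_+ b * tailSum (suc j) (expand digit 0 n)) (multiplicity-digit j)))
        (λ j → sym (m∸n+n≡m (lower f j)))
        (λ {j} N≤j → tailSum-vanishes {j} {expand digit 0 n} (m+n≤o⇒n≤o n N≤j))
        (λ N≤j → vanishes f (m+n≤o⇒m≤o n N≤j))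

      -- The partition with profile `f`; the bound `upper` is exactly what keeps each digit at most
      -- `t`.
      hyper : Hyper b t n
      hyper = record
        { partition = record
          { parts    = expand digit 0 n
          ; positive = All.map (λ { (i , refl) → m^n>0 b i }) expand-digit-powers
          ; sums-to  = trans (sym (tailSum-zero (expand digit 0 n))) (trans (tailSum-digit 0) (at-zero f))
          }
        ; powers  = expand-digit-powers
        ; bounded = multiplicity-bounded expand-digit-powers (λ i → subst (_≤ t) (sym (multiplicity-digit i))
            (m≤n+o⇒m∸n≤o (at f i) (b * at f (suc i)) (subst (at f i ≤_) (+-comm t _) (upper f i))))
        }

    parts↭expand : ∀ x → parts (partition x) ↭ expand (mult x) 0 n
    parts↭expand x = multiplicity⇒↭ (powers x)
      (All.map (λ (i , _ , eq) → i , eq) (expand-powers (mult x) 0 n))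
      (λ { (i , refl) → sym (multiplicity-expand (mult x) 0 n
        (λ {l} → mult-vanishes x ∘ subst (_≤ l) (+-identityʳ n)) {i} z≤n) })

    -- Refinement as the reversed pointwise order

    T-cong : ∀ {x y} → x ≈ y → ∀ j → T x j ≡ T y j
    T-cong x≈y j = floorSum-↭ (b ^ j) {{m^n≢0 b j}} x≈y

    T-injective : ∀ {x y} → (∀ j → T x j ≡ T y j) → x ≈ y
    T-injective {x} {y} eq = multiplicity⇒↭ (powers x) (powers y) λ { (j , refl) →
      +-cancelʳ-≡ (b * T x (suc j)) _ _ (begin
        mult x j + b * T x (suc j)    ≡⟨ T-step x j ⟨
        T x j                         ≡⟨ eq j ⟩
        T y j                         ≡⟨ T-step y j ⟩
        mult y j + b * T y (suc j)    ≡⟨ cong (λ v → mult y j + b * v) (eq (suc j)) ⟨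
        mult y j + b * T x (suc j)    ∎) }
      where open ≡-Reasoning

    T-antitone : ∀ {x y} → x ≼ y → ∀ j → T y j ≤ T x j
    T-antitone {x} {y} x≼y j = floorSum-⊑ (b ^ j) {{m^n≢0 b j}} {μ = partition x} {partition y} x≼y

    -- The difference of the recurrences for `x` and `y`, with the excess of `T x` over `T y` as
    -- carry. Adding `b * T y (suc j)` to both sides replaces the truncated differences by true
    -- ones.
    T-carry : ∀ x y → (∀ j → T y j ≤ T x j) → ∀ j →
              T x j ∸ T y j + mult y j ≡ mult x j + (T x (suc j) ∸ T y (suc j)) * b
    T-carry x y T≤ j = +-cancelʳ-≡ (b * T y (suc j)) _ _ (begin
      (T x j ∸ T y j + mult y j) + b * T y (suc j)     ≡⟨ +-assoc (T x j ∸ T y j) _ _ ⟩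
      T x j ∸ T y j + (mult y j + b * T y (suc j))     ≡⟨ cong (T x j ∸ T y j +_) (T-step y j) ⟨
      T x j ∸ T y j + T y j                            ≡⟨ m∸n+n≡m (T≤ j) ⟩
      T x j                                            ≡⟨ T-step x j ⟩
      mult x j + b * T x (suc j)                       ≡⟨ cong (λ v → mult x j + b * v) (m∸n+n≡m (T≤ (suc j))) ⟨
      mult x j + b * (d + T y (suc j))                 ≡⟨ rearrange (mult x j) b d (T y (suc j)) ⟩
      (mult x j + d * b) + b * T y (suc j)             ∎)
      where
      open ≡-Reasoning
      open +-*-Solver
      d = T x (suc j) ∸ T y (suc j)
      rearrange = solve 4 (λ m b d u → m :+ b :* (d :+ u) := (m :+ d :* b) :+ b :* u) refl

    -- The carry is 0 at level 0, where both sequences equal `n`, and 0 again at level `n`, where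
    -- `T x` vanishes. So `group` starts without groups, ends without leftovers, and sorts the parts
    -- of `y` into groups summing to the parts of `x`.
    T-reflects : ∀ {x y} → (∀ j → T y j ≤ T x j) → x ≼ y
    T-reflects {x} {y} T≤
      with groups , concat↭ , sums≡ ← group {c = λ j → T x j ∸ T y j} {mult y} {mult x} (T-carry x y T≤) n 0
             (trans (cong (_∸ T y (n + 0)) (T-vanishes x (m≤m+n n 0))) (0∸n≡0 (T y (n + 0)))) []
             (cong (λ l → replicate l 1) (sym (trans (cong₂ _∸_ (T-zero x) (T-zero y)) (n∸n≡0 n)))) =
      groups , nonempty , ↭-trans concat↭ (↭-sym (parts↭expand y)) , sums↭
      where
      sums↭ : map sum groups ↭ parts (partition x)
      sums↭ = ↭-trans (↭-reflexive sums≡) (↭-sym (parts↭expand x))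
      nonempty : All (_≢ []) groups
      -- An empty group would have sum 0, but the sums are parts of `x` and hence positive.
      nonempty = All.map (λ { 0<sum refl → <-irrefl refl 0<sum })
        (All.map⁻ (All-resp-↭ (↭-sym sums↭) (positive (partition x))))

    -- Join, meet and distributivity for b at least 2

    -- Finer partitions have smaller `T`, so the join takes the minimum and the meet the maximum.
    _∨_ _∧_ : Hyper b t n → Hyper b t n → Hyper b t n
    x ∨ y = hyper (profile x ⊓ₚ profile y)
    x ∧ y = hyper (profile x ⊔ₚ profile y)

    T-∨ : ∀ x y j → T (x ∨ y) j ≡ T x j ⊓ T y j
    T-∨ x y = tailSum-digit (profile x ⊓ₚ profile y)

    T-∧ : ∀ x y j → T (x ∧ y) j ≡ T x j ⊔ T y j
    T-∧ x y = tailSum-digit (profile x ⊔ₚ profile y)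

    isDistributiveLattice : IsDistributiveLattice _≈_ _≼_ _∨_ _∧_
    isDistributiveLattice = record
      { isLattice = record
        { isPartialOrder = record
          { isPreorder = record
            { isEquivalence = record { refl = ↭-refl ; sym = ↭-sym ; trans = ↭-trans }
            ; reflexive = λ {x} {y} x≈y → T-reflects {x} {y} λ j → ≤-reflexive (sym (T-cong {x} {y} x≈y j))
            -- Transitivity is inherited from the order on ℕ, so groupings need not be composed.
            ; trans = λ {x} {y} {z} x≼y y≼z → T-reflects {x} {z} λ j →
                ≤-trans (T-antitone {y} {z} y≼z j) (T-antitone {x} {y} x≼y j)
            }
          ; antisym = λ {x} {y} x≼y y≼x → T-injective {x} {y} λ j →
              ≤-antisym (T-antitone {y} {x} y≼x j) (T-antitone {x} {y} x≼y j)
          }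
        ; supremum = λ x y →
            T-reflects {x} {x ∨ y} (λ j → subst (_≤ T x j) (sym (T-∨ x y j)) (m⊓n≤m _ _)) ,
            T-reflects {y} {x ∨ y} (λ j → subst (_≤ T y j) (sym (T-∨ x y j)) (m⊓n≤n _ _)) ,
            λ z x≼z y≼z → T-reflects {x ∨ y} {z} λ j → subst (T z j ≤_) (sym (T-∨ x y j))
              (⊓-glb (T-antitone {x} {z} x≼z j) (T-antitone {y} {z} y≼z j))
        ; infimum = λ x y →
            T-reflects {x ∧ y} {x} (λ j → subst (T x j ≤_) (sym (T-∧ x y j)) (m≤m⊔n _ _)) ,
            T-reflects {x ∧ y} {y} (λ j → subst (T y j ≤_) (sym (T-∧ x y j)) (m≤n⊔m _ _)) ,
            λ z z≼x z≼y → T-reflects {z} {x ∧ y} λ j → subst (_≤ T z j) (sym (T-∧ x y j))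
              (⊔-lub (T-antitone {z} {x} z≼x j) (T-antitone {z} {y} z≼y j))
        }
      ; ∧-distribˡ-∨ = λ x y z → T-injective {x ∧ (y ∨ z)} {(x ∧ y) ∨ (x ∧ z)} λ j → begin
          T (x ∧ (y ∨ z)) j                    ≡⟨ T-∧ x (y ∨ z) j ⟩
          T x j ⊔ T (y ∨ z) j                  ≡⟨ cong (T x j ⊔_) (T-∨ y z j) ⟩
          T x j ⊔ (T y j ⊓ T z j)              ≡⟨ ⊔-distribˡ-⊓ (T x j) (T y j) (T z j) ⟩
          (T x j ⊔ T y j) ⊓ (T x j ⊔ T z j)    ≡⟨ cong₂ _⊓_ (T-∧ x y j) (T-∧ x z j) ⟨
          T (x ∧ y) j ⊓ T (x ∧ z) j            ≡⟨ T-∨ (x ∧ y) (x ∧ z) j ⟨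
          T ((x ∧ y) ∨ (x ∧ z)) j              ∎
      }
      where open ≡-Reasoning

    ∨-distribˡ-∧ : _DistributesOverˡ_ _≈_ _∨_ _∧_
    ∨-distribˡ-∧ x y z = T-injective {x ∨ (y ∧ z)} {(x ∨ y) ∧ (x ∨ z)} λ j → begin
      T (x ∨ (y ∧ z)) j                    ≡⟨ T-∨ x (y ∧ z) j ⟩
      T x j ⊓ T (y ∧ z) j                  ≡⟨ cong (T x j ⊓_) (T-∧ y z j) ⟩
      T x j ⊓ (T y j ⊔ T z j)              ≡⟨ ⊓-distribˡ-⊔ (T x j) (T y j) (T z j) ⟩
      (T x j ⊓ T y j) ⊔ (T x j ⊓ T z j)    ≡⟨ cong₂ _⊔_ (T-∨ x y j) (T-∨ x z j) ⟨
      T (x ∨ y) j ⊔ T (x ∨ z) j            ≡⟨ T-∧ (x ∨ y) (x ∨ z) j ⟨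
      T ((x ∨ y) ∧ (x ∨ z)) j              ∎
      where open ≡-Reasoning

-- The degenerate base b = 1

module _ {t n : ℕ} where

  all-ones : ∀ {xs} → All (λ p → ∃[ j ] p ≡ 1 ^ j) xs → xs ≡ replicate (sum xs) 1
  all-ones [] = refl
  all-ones ((j , refl) ∷ pxs) rewrite ^-zeroˡ j = cong (1 ∷_) (all-ones pxs)

  parts-unique : (x y : Hyper 1 t n) → parts (partition x) ≡ parts (partition y)
  parts-unique x y = begin
    parts (partition x)                           ≡⟨ all-ones (powers x) ⟩
    replicate (sum (parts (partition x))) 1       ≡⟨ cong (λ k → replicate k 1)
                                                       (trans (sums-to (partition x)) (sym (sums-to (partition y)))) ⟩
    replicate (sum (parts (partition y))) 1       ≡⟨ all-ones (powers y) ⟨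
    parts (partition y)                           ∎
    where open ≡-Reasoning

  ≈-total : (x y : Hyper 1 t n) → x ≈ y
  ≈-total x y = ↭-reflexive (parts-unique x y)

  -- Each part of `y` forms a group of its own, as `x` and `y` have the same parts.
  ≼-total : (x y : Hyper 1 t n) → x ≼ y
  ≼-total x y =
    map [_] (parts (partition y)) ,
    All.map⁺ (All.universal (λ _ ()) _) ,
    ↭-reflexive (concat-map-[ parts (partition y) ]) ,
    ↭-trans (↭-reflexive map-sum) (≈-total y x)
    where
    map-sum : map sum (map [_] (parts (partition y))) ≡ parts (partition y)
    map-sum = trans (sym (map-∘ (parts (partition y)))) (trans (map-cong +-identityʳ _) (map-id _))

  -- All elements being equivalent, the first projection serves as both join and meet.
  isDistributiveLattice-1 : IsDistributiveLattice {A = Hyper 1 t n} _≈_ _≼_ (λ x _ → x) (λ x _ → x)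
  isDistributiveLattice-1 = record
    { isLattice = record
      { isPartialOrder = record
        { isPreorder = record
          { isEquivalence = record { refl = ↭-refl ; sym = ↭-sym ; trans = ↭-trans }
          ; reflexive = λ {x} {y} _ → ≼-total x y
          ; trans = λ {x} {_} {z} _ _ → ≼-total x z
          }
        ; antisym = λ {x} {y} _ _ → ≈-total x y
        }
      ; supremum = λ x y → ≼-total x x , ≼-total y x , λ z _ _ → ≼-total x z
      ; infimum = λ x y → ≼-total x x , ≼-total x y , λ z _ _ → ≼-total z x
      }
    ; ∧-distribˡ-∨ = λ _ _ _ → ↭-refl
    }

-- The cases b = 1 and b at least 2 combined

theorem3p10 : (b t n : ℕ) → 0 < b → 0 < t → 0 < n → b ≤ t →
    ∃₂ λ (_∨_ _∧_ : Hyper b t n → Hyper b t n → Hyper b t n) →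
    IsDistributiveLattice _≈_ _≼_ _∨_ _∧_ ×
    _DistributesOverˡ_ _≈_ _∨_ _∧_
theorem3p10 1                 t n _ _ _ _ = _ , _ , isDistributiveLattice-1 , λ _ _ _ → ↭-refl
theorem3p10 b@(suc (suc _))   t n _ _ _ _ = _∨_ , _∧_ , isDistributiveLattice , ∨-distribˡ-∧
  where open Radix b (s≤s z<s)
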